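{- Let $W_3(n)$ be a uniformly random word of length $n$ over a $3$-letter alphabet. Then, with probability $1-e^{ -\Omega(n/\log n)}$ (as $n\to\infty$), $$t(W_3(n))\ge 0.411\, n.$$
   Context: A word $w=w_1w_2\cdots w_n$ over a finite alphabet $A$ contains twins of length $t$ if there exist disjoint sets of indices $\{i_1<\cdots<i_t\}$ and $\{j_1<\cdots<j_t\}$ in $\{1,\dots,n\}$ with $w_{i_1}\cdots w_{i_t}=w_{j_1}\cdots w_{j_t}$. $t(w)$ denotes the maximum length of twins in $w$. $W_k(n)$ denotes a word chosen uniformly at random among all $k^n$ words of length $n$ over a $k$-letter alphabet (equivalently, $n$ independent uniform letters). -}

module Defs where

open import Data.Nat using (ℕ; suc; _+_; _*_; _^_; _≤_; _/_)
open import Data.Nat.Logarithm using (⌊log₂_⌋)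
open import Data.Fin using (Fin) renaming (_<_ to _<ᶠ_)
open import Data.Vec using (Vec; lookup)
open import Data.List using (List; length)
open import Data.List.Relation.Unary.All using (All)
open import Data.List.Relation.Unary.Unique.Propositional using (Unique)
open import Data.Product using (Σ; ∃; _×_)
open import Relation.Binary.PropositionalEquality using (_≡_; _≢_)
open import Relation.Nullary using (¬_)

Word : ℕ → ℕ → Set
Word k n = Vec (Fin k) n

StrictlyIncreasing : {t n : ℕ} → (Fin t → Fin n) → Set
StrictlyIncreasing {t} f = ∀ (a b : Fin t) → a <ᶠ b → f a <ᶠ f b

Twins : {k n : ℕ} → Word k n → ℕ → Set
Twins {k} {n} w t =
  Σ (Fin t → Fin n) λ f → Σ (Fin t → Fin n) λ g →
    StrictlyIncreasing f × StrictlyIncreasing g ×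
    (∀ a b → f a ≢ g b) ×
    (∀ a → lookup w (f a) ≡ lookup w (g a))

TwinsAtLeast0411 : {k n : ℕ} → Word k n → Set
TwinsAtLeast0411 {k} {n} w = ∃ λ t → (411 * n ≤ 1000 * t) × Twins w t

-- The word is read from its right end by a finite-state strategy. The leading
-- twin takes letters; those not yet copied by the other twin wait in a queue of
-- at most five letters. Each letter a of the word is either added to the queue,
-- or given to the other twin as the copy of the oldest a in the queue, whereby
-- the letters that waited longer than this a are abandoned.
--
-- A letter that completes a pair has weight 2, every other letter weight 3. The
-- strategy chooses between the two moves by a potential φ on queues, a value
-- iterate for the expected weight; a computation over the 364 queues shows that
-- 100 times the sum over the three letters of (weight × next potential) is at
-- most 761 φ. Hence the sum of 2 ^ t(w) * 3 ^ (n ∸ t(w)) over all words w is at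
-- most C (761 / 100) ^ n, where t(w) is the length of the twins found. A word
-- with t(w) < 0.411 n contributes at least (2 ^ 0.411 * 3 ^ 0.589) ^ n, and
-- 761 / 100 < 3 * 2 ^ 0.411 * 3 ^ 0.589 bounds the proportion of such words by an
-- exponentially small quantity.
module Submission where

open import Defs
open import Data.Bool using (Bool; true; false; if_then_else_)
open import Data.Fin as Fin using (Fin; zero; suc)
import Data.Fin.Properties as Fin
open import Data.List using (List; []; _∷_; _++_; length; map; take; allFin; cartesianProductWith)
import Data.List as List
open import Data.List.Membership.Propositional using (_∈_)
open import Data.List.Membership.Propositional.Properties using (∈-∃++; ∈-++⁺ˡ; ∈-++⁺ʳ; ∈-++⁻; ∈-allFin; ∈-cartesianProductWith⁺)
open import Data.List.Properties using (map-++; map-∘; ++-assoc; take-[])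
open import Data.List.Relation.Binary.Permutation.Propositional.Properties using (shift; map⁺)
open import Data.List.Relation.Binary.Sublist.Propositional using (_⊆_; []; _∷_; _∷ʳ_; ⊆-refl)
open import Data.List.Relation.Binary.Sublist.Propositional.Properties using (take-⊆; ++⁺; ++⁺ˡ)
open import Data.List.Relation.Unary.All as All using (All; []; _∷_; all?)
open import Data.List.Relation.Unary.AllPairs using ([]; _∷_)
open import Data.List.Relation.Unary.Any using (here; there)
open import Data.List.Relation.Unary.Unique.Propositional using (Unique)
open import Data.Maybe using (Maybe; just; nothing; maybe)
open import Data.Nat using (ℕ; zero; suc; _+_; _*_; _^_; _∸_; _≤_; _/_; _≤ᵇ_; _≤?_; z≤n; s≤s; NonZero; >-nonZero)
open import Data.Nat.DivMod using (m/n*n≤m; /-monoˡ-≤; m*n/n≡m)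
open import Data.Nat.ListAction using (sum)
open import Data.Nat.ListAction.Properties using (sum-++; sum-↭)
open import Data.Nat.Logarithm using (⌊log₂_⌋)
open import Data.Nat.Properties
open import Algebra.Properties.CommutativeSemigroup *-commutativeSemigroup using (interchange; x∙yz≈y∙xz; xy∙z≈xz∙y; xy∙z≈y∙xz; xy∙z≈y∙zx)
open import Data.Nat.Tactic.RingSolver using (solve-∀)
open import Data.Product using (Σ; ∃; _×_; _,_; proj₁; proj₂)
open import Data.Sum using (inj₁; inj₂)
open import Data.Vec as Vec using (Vec; []; _∷_)
open import Function using (_∘_)
open import Relation.Binary.PropositionalEquality
open import Relation.Nullary using (Dec; yes; no; ¬_; contradiction)
open import Relation.Nullary.Decidable using (toWitness; _×-dec_; does)

private variable
  A B : Set
  k n : ℕ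
  w : Vec A n
  xs ys zs : List A

-- Pairs of subsequences at disjoint positions

-- One constructor per letter, added at the left end: a strategy that reads the word from its right
-- end extends its split by a single constructor at each step.
data Split {A : Set} : ∀ {n} → Vec A n → List A → List A → Set where
  []    : Split [] [] []
  left  : ∀ {a} → Split w xs ys → Split (a ∷ w) (a ∷ xs) ys
  right : ∀ {a} → Split w xs ys → Split (a ∷ w) xs (a ∷ ys)
  skip  : ∀ {a} → Split w xs ys → Split (a ∷ w) xs ys

swap : Split w xs ys → Split w ys xs
swap []        = []
swap (left s)  = right (swap s)
swap (right s) = left (swap s)
swap (skip s)  = skip (swap s)

-- A letter dropped from the first subsequence becomes a skipped position. This is how letters in
-- the queue are abandoned.
restrictˡ : zs ⊆ xs → Split w xs ys → Split w zs ys
restrictˡ []         []        = []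
restrictˡ (_ ∷ʳ τ)   (left s)  = skip (restrictˡ τ s)
restrictˡ (refl ∷ τ) (left s)  = left (restrictˡ τ s)
restrictˡ τ          (right s) = right (restrictˡ τ s)
restrictˡ τ          (skip s)  = skip (restrictˡ τ s)

position : {w : Vec A n} → Split w xs ys → Fin (length xs) → Fin n
position (left s)  zero    = zero
position (left s)  (suc i) = suc (position s i)
position (right s) i       = suc (position s i)
position (skip s)  i       = suc (position s i)

position-increasing : (s : Split w xs ys) → StrictlyIncreasing (position s)
position-increasing (left s)  zero    (suc j) _         = s≤s z≤n
position-increasing (left s)  (suc i) (suc j) (s≤s i<j) = s≤s (position-increasing s i j i<j)
position-increasing (right s) i       j       i<j       = s≤s (position-increasing s i j i<j)
position-increasing (skip s)  i       j       i<j       = s≤s (position-increasing s i j i<j)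

lookup-position : (s : Split w xs ys) → ∀ i → Vec.lookup w (position s i) ≡ List.lookup xs i
lookup-position (left s)  zero    = refl
lookup-position (left s)  (suc i) = lookup-position s i
lookup-position (right s) i       = lookup-position s i
lookup-position (skip s)  i       = lookup-position s i

position-disjoint : (s : Split w xs ys) → ∀ i j → position s i ≢ position (swap s) j
position-disjoint (left s)  zero    j       ()
position-disjoint (left s)  (suc i) j       eq = position-disjoint s i j (Fin.suc-injective eq)
position-disjoint (right s) i       zero    ()
position-disjoint (right s) i       (suc j) eq = position-disjoint s i j (Fin.suc-injective eq)
position-disjoint (skip s)  i       j       eq = position-disjoint s i j (Fin.suc-injective eq)

split⇒twins : {w : Word k n} → Split w xs xs → Twins w (length xs)
split⇒twins s =
  position s , position (swap s) ,
  position-increasing s , position-increasing (swap s) ,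
  position-disjoint s ,
  λ i → trans (lookup-position s i) (sym (lookup-position (swap s) i))

-- Sums over lists

sum-map-mono : {f g : A → ℕ} → All (λ x → f x ≤ g x) xs → sum (map f xs) ≤ sum (map g xs)
sum-map-mono []         = z≤n
sum-map-mono (le ∷ les) = +-mono-≤ le (sum-map-mono les)

sum-map-*ˡ : ∀ c (f : A → ℕ) xs → sum (map (λ x → c * f x) xs) ≡ c * sum (map f xs)
sum-map-*ˡ c f []       = sym (*-zeroʳ c)
sum-map-*ˡ c f (x ∷ xs) = trans (cong (c * f x +_) (sum-map-*ˡ c f xs)) (sym (*-distribˡ-+ c (f x) _))

length*≤sum-map : ∀ {c} {f : A → ℕ} → All (λ x → c ≤ f x) xs → length xs * c ≤ sum (map f xs)
length*≤sum-map []         = z≤n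
length*≤sum-map (le ∷ les) = +-mono-≤ le (length*≤sum-map les)

sum-cartesianProductWith : ∀ {C : Set} (f : C → ℕ) (g : A → B → C) xs ys →
  sum (map f (cartesianProductWith g xs ys)) ≡ sum (map (λ x → sum (map (f ∘ g x) ys)) xs)
sum-cartesianProductWith f g []       ys = refl
sum-cartesianProductWith f g (x ∷ xs) ys = begin
  sum (map f (map (g x) ys ++ rest))                  ≡⟨ cong sum (map-++ f (map (g x) ys) rest) ⟩
  sum (map f (map (g x) ys) ++ map f rest)            ≡⟨ sum-++ (map f (map (g x) ys)) _ ⟩
  sum (map f (map (g x) ys)) + sum (map f rest)       ≡⟨ cong₂ _+_ (cong sum (sym (map-∘ ys))) (sum-cartesianProductWith f g xs ys) ⟩
  sum (map (f ∘ g x) ys) + sum (map (λ x → sum (map (f ∘ g x) ys)) xs) ∎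
  where
  open ≡-Reasoning
  rest = cartesianProductWith g xs ys

-- Cut `x` out of `ys`: since the entries of `xs` are distinct, the others survive the cut and the
-- induction goes on.
sum-unique-≤ : (f : A → ℕ) → Unique xs → All (_∈ ys) xs → sum (map f xs) ≤ sum (map f ys)
sum-unique-≤ f [] [] = z≤n
sum-unique-≤ {xs = x ∷ xs} f (x∉xs ∷ xs!) (x∈ys ∷ xs⊆ys) with ps , qs , refl ← ∈-∃++ x∈ys = begin
  f x + sum (map f xs)          ≤⟨ +-monoʳ-≤ (f x) (sum-unique-≤ f xs! (All.zipWith (λ (x≢ , y∈) → remove x≢ y∈) (x∉xs , xs⊆ys))) ⟩
  f x + sum (map f (ps ++ qs))  ≡⟨ sum-↭ (map⁺ f (shift x ps qs)) ⟨
  sum (map f (ps ++ x ∷ qs))    ∎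
  where
  open ≤-Reasoning
  remove : ∀ {y} → x ≢ y → y ∈ ps ++ x ∷ qs → y ∈ ps ++ qs
  remove x≢y y∈ with ∈-++⁻ ps y∈
  ... | inj₁ y∈ps         = ∈-++⁺ˡ y∈ps
  ... | inj₂ (here refl)  = contradiction refl x≢y
  ... | inj₂ (there y∈qs) = ∈-++⁺ʳ ps y∈qs

-- The tail is the outer index, so a sum over words groups by the state reached before the last
-- letter is read.
words : ∀ k n → List (Word k n)
words k zero    = [] ∷ []
words k (suc n) = cartesianProductWith (λ w a → a ∷ w) (words k n) (allFin k)

∈-words : (w : Word k n) → w ∈ words k n
∈-words []      = here refl
∈-words (a ∷ w) = ∈-cartesianProductWith⁺ (λ w a → a ∷ w) (∈-words w) (∈-allFin a)

-- Powers

^-distribʳ-* : ∀ o m n → (m * n) ^ o ≡ m ^ o * n ^ o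
^-distribʳ-* zero    m n = refl
^-distribʳ-* (suc o) m n = trans (cong (m * n *_) (^-distribʳ-* o m n)) (interchange m n (m ^ o) (n ^ o))

^-cancelʳ-≤ : ∀ o .{{_ : NonZero o}} {m n} → m ^ o ≤ n ^ o → m ≤ n
^-cancelʳ-≤ o le = ≮⇒≥ (λ n<m → <⇒≱ (^-monoˡ-< o n<m) le)

^-comm : ∀ m n o → (m ^ n) ^ o ≡ (m ^ o) ^ n
^-comm m n o = trans (^-*-assoc m n o) (trans (cong (m ^_) (*-comm n o)) (sym (^-*-assoc m o n)))

-- With the total exponent fixed, the left side arises by turning `x′ ∸ x` factors `q` into the
-- smaller `p`.
^-exchange-≤ : ∀ {p q x x′ y y′} → p ≤ q → x ≤ x′ → x + y ≡ x′ + y′ → p ^ x′ * q ^ y′ ≤ p ^ x * q ^ y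
^-exchange-≤ {p} {q} {x} {x′} {y} {y′} p≤q x≤x′ eq with d , refl ← m≤n⇒∃[o]m+o≡n x≤x′ = begin
  p ^ (x + d) * q ^ y′    ≡⟨ cong (_* q ^ y′) (^-distribˡ-+-* p x d) ⟩
  p ^ x * p ^ d * q ^ y′  ≤⟨ *-monoˡ-≤ (q ^ y′) (*-monoʳ-≤ (p ^ x) (^-monoˡ-≤ d p≤q)) ⟩
  p ^ x * q ^ d * q ^ y′  ≡⟨ *-assoc (p ^ x) (q ^ d) (q ^ y′) ⟩
  p ^ x * (q ^ d * q ^ y′) ≡⟨ cong (p ^ x *_) (^-distribˡ-+-* q d y′) ⟨
  p ^ x * q ^ (d + y′)    ≡⟨ cong (λ y → p ^ x * q ^ y) (+-cancelˡ-≡ x y (d + y′) (trans eq (+-assoc x d y′))) ⟨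
  p ^ x * q ^ y           ∎
  where open ≤-Reasoning

-- Strategies

queues : (k L : ℕ) → List (List (Fin k))
queues k zero    = [] ∷ []
queues k (suc L) = [] ∷ cartesianProductWith _∷_ (allFin k) (queues k L)

take-∈-queues : ∀ L (u : List (Fin k)) → take L u ∈ queues k L
take-∈-queues zero    u       = here refl
take-∈-queues (suc L) []      = here refl
take-∈-queues (suc L) (a ∷ u) = there (∈-cartesianProductWith⁺ _∷_ (∈-allFin a) (take-∈-queues L u))

-- A queue lists its newest letter first.
dropToOldest : Fin k → List (Fin k) → Maybe (List (Fin k))
dropToOldest a []      = nothing
dropToOldest a (b ∷ u) with dropToOldest a u
-- An occurrence further down the list is older and takes precedence over `b`.
... | just v  = just (b ∷ v)
... | nothing = if does (a Fin.≟ b) then just [] else nothing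

dropToOldest-sound : ∀ (a : Fin k) u {v} → dropToOldest a u ≡ just v → ∃ λ d → u ≡ v ++ a ∷ d
dropToOldest-sound a (b ∷ u) eq with dropToOldest a u in eq′
dropToOldest-sound a (b ∷ u) refl | just v with d , refl ← dropToOldest-sound a u eq′ = d , refl
dropToOldest-sound a (b ∷ u) eq   | nothing with a Fin.≟ b
dropToOldest-sound a (b ∷ u) refl | nothing | yes refl = u , refl

-- (true , v) pairs the letter read and leaves the queue v, (false , v) does not.
Move : ℕ → Set
Move k = Bool × List (Fin k)

data Legal {k} (a : Fin k) : List (Fin k) → Move k → Set where
  push : ∀ {u} → Legal a u (false , a ∷ u)
  pair : ∀ {v d} → Legal a (v ++ a ∷ d) (true , v)

module Strategy (k L p q : ℕ) (φ : List (Fin k) → ℕ) where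

  cost : Move k → ℕ
  cost (b , u) = (if b then p else q) * φ (take L u)

  cheaper : Move k → Move k → Move k
  cheaper m m′ = if cost m ≤ᵇ cost m′ then m else m′

  move : Fin k → List (Fin k) → Move k
  move a u = maybe (λ v → cheaper (true , v) (false , a ∷ u)) (false , a ∷ u) (dropToOldest a u)

  legal-move : ∀ a u → Legal a u (move a u)
  legal-move a u with dropToOldest a u in eq
  ... | nothing = push
  ... | just v with cost (true , v) ≤ᵇ cost (false , a ∷ u) | dropToOldest-sound a u eq
  ...   | true  | d , refl = pair
  ...   | false | _        = push

  totalCost : List (Fin k) → ℕ
  totalCost u = sum (map (λ a → cost (move a u)) (allFin k))

  -- The second inequality lets the total potential grow by a factor of at most `P / D` per letter;
  -- positivity makes the potential dominate the weight.
  Certificate : (P D : ℕ) → Set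
  Certificate P D = All (λ u → 1 ≤ φ u × D * totalCost u ≤ P * φ u) (queues k L)

  certificate? : ∀ P D → Dec (Certificate P D)
  certificate? P D = all? (λ u → 1 ≤? φ u ×-dec (D * totalCost u ≤? P * φ u)) (queues k L)

  -- Runs of a strategy and the twins they find

  record State : Set where
    constructor state
    field
      queue     : List (Fin k)
      twin      : List (Fin k)
      #unpaired : ℕ

  open State

  apply : Fin k → Move k → State → State
  apply a (true  , v) (state _ y s) = state (take L v) (a ∷ y) s
  apply a (false , v) (state _ y s) = state (take L v) y (suc s)

  step : Fin k → State → State
  step a σ = apply a (move a (queue σ)) σ

  run : Word k n → State
  run []      = state [] [] 0
  run (a ∷ w) = step a (run w)

  -- The leading twin has taken the queue and the paired letters, the other twin the paired letters
  -- only. A push extends the former; a pair extends the latter, and restriction discards `d` and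
  -- any overflow beyond `L`.
  apply-split : ∀ {a m} {w : Word k n} σ → Legal a (queue σ) m →
    Split w (queue σ ++ twin σ) (twin σ) →
    Split (a ∷ w) (queue (apply a m σ) ++ twin (apply a m σ)) (twin (apply a m σ))
  apply-split {a = a} (state u y _) push s = restrictˡ (++⁺ (take-⊆ L (a ∷ u)) ⊆-refl) (left s)
  apply-split {a = a} (state _ y _) (pair {v} {d}) s =
    right (restrictˡ (subst (take L v ++ a ∷ y ⊆_) (sym (++-assoc v (a ∷ d) y))
                            (++⁺ (take-⊆ L v) (refl ∷ ++⁺ˡ d ⊆-refl))) s)

  run-split : (w : Word k n) → Split w (queue (run w) ++ twin (run w)) (twin (run w))
  run-split []      = []
  run-split (a ∷ w) = apply-split (run w) (legal-move a (queue (run w))) (run-split w)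

  run-twins : (w : Word k n) → Twins w (length (twin (run w)))
  run-twins w = split⇒twins (restrictˡ (++⁺ˡ (queue (run w)) ⊆-refl) (run-split w))

  run-size : (w : Word k n) → length (twin (run w)) + #unpaired (run w) ≡ n
  run-size []      = refl
  run-size (a ∷ w) = trans (apply-size (move a (queue (run w))) (run w)) (cong suc (run-size w))
    where
    apply-size : ∀ m σ → length (twin (apply a m σ)) + #unpaired (apply a m σ) ≡ suc (length (twin σ) + #unpaired σ)
    apply-size (true  , _) σ = refl
    apply-size (false , _) σ = +-suc (length (twin σ)) (#unpaired σ)

  run-queue : (w : Word k n) → queue (run w) ∈ queues k L
  run-queue []      = subst (_∈ queues k L) (take-[] L) (take-∈-queues L [])
  run-queue (a ∷ w) with move a (queue (run w))
  ... | true  , v = take-∈-queues L v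
  ... | false , v = take-∈-queues L v

  -- Growth of the weighted potential over all words

  weight : State → ℕ
  weight σ = p ^ length (twin σ) * q ^ #unpaired σ

  Ψ : State → ℕ
  Ψ σ = weight σ * φ (queue σ)

  Ψ-apply : ∀ a m σ → Ψ (apply a m σ) ≡ weight σ * cost m
  Ψ-apply a (true  , v) σ = rearrange p (p ^ length (twin σ)) (q ^ #unpaired σ) (φ (take L v))
    where
    rearrange : ∀ x y z t → x * y * z * t ≡ y * z * (x * t)
    rearrange = solve-∀
  Ψ-apply a (false , v) σ = rearrange q (p ^ length (twin σ)) (q ^ #unpaired σ) (φ (take L v))
    where
    rearrange : ∀ x y z t → y * (x * z) * t ≡ y * z * (x * t)
    rearrange = solve-∀

  module _ {P D} (cert : Certificate P D) where

    Ψ-step : (w : Word k n) → D * sum (map (λ a → Ψ (run (a ∷ w))) (allFin k)) ≤ P * Ψ (run w)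
    Ψ-step w = begin
      D * sum (map (λ a → Ψ (run (a ∷ w))) (allFin k))          ≤⟨ *-monoʳ-≤ D (sum-map-mono {xs = allFin k} (All.universal (λ a → ≤-reflexive (Ψ-apply a (move a u) σ)) _)) ⟩
      D * sum (map (λ a → weight σ * cost (move a u)) (allFin k)) ≡⟨ cong (D *_) (sum-map-*ˡ (weight σ) _ (allFin k)) ⟩
      D * (weight σ * totalCost u)                                ≡⟨ x∙yz≈y∙xz D (weight σ) (totalCost u) ⟩
      weight σ * (D * totalCost u)                                ≤⟨ *-monoʳ-≤ (weight σ) (proj₂ (All.lookup cert (run-queue w))) ⟩
      weight σ * (P * φ u)                                        ≡⟨ x∙yz≈y∙xz (weight σ) P (φ u) ⟩
      P * Ψ σ                                                     ∎
      where
      open ≤-Reasoning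
      σ = run w
      u = queue σ

    sum-Ψ : ∀ n → D ^ n * sum (map (Ψ ∘ run) (words k n)) ≤ P ^ n * φ []
    sum-Ψ zero    = ≤-reflexive (lemma (φ []))
      where
      lemma : ∀ x → 1 * (1 * 1 * x + 0) ≡ 1 * x
      lemma = solve-∀
    sum-Ψ (suc n) = begin
      D * D ^ n * sum (map (Ψ ∘ run) (words k (suc n)))  ≡⟨ cong (D * D ^ n *_) (sum-cartesianProductWith (Ψ ∘ run) _ (words k n) (allFin k)) ⟩
      D * D ^ n * sum (map S (words k n))                 ≡⟨ xy∙z≈y∙xz D (D ^ n) _ ⟩
      D ^ n * (D * sum (map S (words k n)))               ≡⟨ cong (D ^ n *_) (sum-map-*ˡ D S (words k n)) ⟨
      D ^ n * sum (map (λ w → D * S w) (words k n))       ≤⟨ *-monoʳ-≤ (D ^ n) (sum-map-mono {xs = words k n} (All.universal Ψ-step _)) ⟩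
      D ^ n * sum (map (λ w → P * Ψ (run w)) (words k n)) ≡⟨ cong (D ^ n *_) (sum-map-*ˡ P (Ψ ∘ run) (words k n)) ⟩
      D ^ n * (P * sum (map (Ψ ∘ run) (words k n)))       ≡⟨ x∙yz≈y∙xz (D ^ n) P _ ⟩
      P * (D ^ n * sum (map (Ψ ∘ run) (words k n)))       ≤⟨ *-monoʳ-≤ P (sum-Ψ n) ⟩
      P * (P ^ n * φ [])                                  ≡⟨ *-assoc P (P ^ n) (φ []) ⟨
      P * P ^ n * φ []                                    ∎
      where
      open ≤-Reasoning
      S : Word k n → ℕ
      S w = sum (map (λ a → Ψ (run (a ∷ w))) (allFin k))

    -- Markov's inequality in counting form: each listed word contributes at least `c` to the sum of
    -- `Ψ` over all words.
    count-≤ : ∀ n c (ws : List (Word k n)) → Unique ws → All (λ w → c ≤ weight (run w)) ws →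
      D ^ n * (length ws * c) ≤ P ^ n * φ []
    count-≤ n c ws ws! heavy = begin
      D ^ n * (length ws * c)                       ≤⟨ *-monoʳ-≤ (D ^ n) (length*≤sum-map (All.map (λ {w} → c≤Ψ w) heavy)) ⟩
      D ^ n * sum (map (Ψ ∘ run) ws)                ≤⟨ *-monoʳ-≤ (D ^ n) (sum-unique-≤ (Ψ ∘ run) ws! (All.universal ∈-words ws)) ⟩
      D ^ n * sum (map (Ψ ∘ run) (words k n))       ≤⟨ sum-Ψ n ⟩
      P ^ n * φ []                                  ∎
      where
      open ≤-Reasoning
      c≤Ψ : ∀ w → c ≤ weight (run w) → c ≤ Ψ (run w)
      c≤Ψ w c≤ = ≤-trans c≤ (m≤m*n _ _ {{>-nonZero (proj₁ (All.lookup cert (run-queue w)))}})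

    -- gap is P / D < k p^ρ q^(1 − ρ) for the rate ρ = r / (r + r′), with a factor 2 to
    -- spare, raised to the power r + r′ to clear the fractional exponents.
    few-bad-words : ∀ {r r′ ℓ} .{{_ : NonZero p}} .{{_ : NonZero q}} .{{_ : NonZero D}} .{{_ : NonZero (r + r′)}} →
      let m = r + r′ in
      p ≤ q → φ [] ≤ 2 ^ ℓ → P ^ m * 2 ≤ D ^ m * (p ^ r * q ^ r′) * k ^ m →
      ∀ n e → m * e + m * ℓ ≤ n → (ws : List (Word k n)) → Unique ws →
      All (λ w → m * length (twin (run w)) ≤ r * n) ws → length ws * 2 ^ e ≤ k ^ n
    few-bad-words {r} {r′} {ℓ} p≤q φ[]≤2^ℓ gap n e small ws ws! short =
      ^-cancelʳ-≤ m (*-cancelʳ-≤ _ _ ((2 ^ ℓ) ^ m * V ^ n) {{m*n≢0 _ _ {{m^n≢0 (2 ^ ℓ) m {{m^n≢0 2 ℓ}}}} {{V^n≢0}}}} (begin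
        (b * 2 ^ e) ^ m * ((2 ^ ℓ) ^ m * V ^ n)                  ≡⟨ cong₂ (λ x y → x * ((2 ^ ℓ) ^ m * y)) (^-distribʳ-* m b (2 ^ e)) (^-distribʳ-* n (D ^ m) U) ⟩
        b ^ m * (2 ^ e) ^ m * ((2 ^ ℓ) ^ m * ((D ^ m) ^ n * U ^ n))  ≤⟨ *-monoʳ-≤ (b ^ m * (2 ^ e) ^ m) (*-monoʳ-≤ ((2 ^ ℓ) ^ m) (*-monoʳ-≤ ((D ^ m) ^ n) U^n≤c^m)) ⟩
        b ^ m * (2 ^ e) ^ m * ((2 ^ ℓ) ^ m * ((D ^ m) ^ n * c ^ m))  ≡⟨ cong (λ x → b ^ m * (2 ^ e) ^ m * ((2 ^ ℓ) ^ m * (x * c ^ m))) (^-comm D m n) ⟩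
        b ^ m * (2 ^ e) ^ m * ((2 ^ ℓ) ^ m * ((D ^ n) ^ m * c ^ m))  ≡⟨ rearrange (b ^ m) ((2 ^ e) ^ m) ((2 ^ ℓ) ^ m) ((D ^ n) ^ m) (c ^ m) ⟩
        (D ^ n) ^ m * (b ^ m * c ^ m) * ((2 ^ e) ^ m * (2 ^ ℓ) ^ m)  ≡⟨ cong₂ _*_ (trans (cong ((D ^ n) ^ m *_) (sym (^-distribʳ-* m b c))) (sym (^-distribʳ-* m (D ^ n) (b * c)))) 2^[me+mℓ] ⟩
        -- The hypothesis `small` raises the power of 2 to `2 ^ n`, which the factor 2 in `gap` then
        -- absorbs.
        (D ^ n * (b * c)) ^ m * 2 ^ (m * e + m * ℓ)                  ≤⟨ *-mono-≤ (^-monoˡ-≤ m (≤-trans (count-≤ n c ws ws! (All.map (λ {w} → heavy w) short)) (*-monoʳ-≤ (P ^ n) φ[]≤2^ℓ))) (^-monoʳ-≤ 2 small) ⟩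
        (P ^ n * 2 ^ ℓ) ^ m * 2 ^ n                                  ≡⟨ cong (_* 2 ^ n) (trans (^-distribʳ-* m (P ^ n) (2 ^ ℓ)) (cong (_* (2 ^ ℓ) ^ m) (^-comm P n m))) ⟩
        (P ^ m) ^ n * (2 ^ ℓ) ^ m * 2 ^ n                            ≡⟨ xy∙z≈xz∙y ((P ^ m) ^ n) ((2 ^ ℓ) ^ m) (2 ^ n) ⟩
        (P ^ m) ^ n * 2 ^ n * (2 ^ ℓ) ^ m                            ≡⟨ cong (_* (2 ^ ℓ) ^ m) (^-distribʳ-* n (P ^ m) 2) ⟨
        (P ^ m * 2) ^ n * (2 ^ ℓ) ^ m                                ≤⟨ *-monoˡ-≤ ((2 ^ ℓ) ^ m) (^-monoˡ-≤ n gap) ⟩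
        (V * k ^ m) ^ n * (2 ^ ℓ) ^ m                                ≡⟨ cong (_* (2 ^ ℓ) ^ m) (trans (^-distribʳ-* n V (k ^ m)) (cong (V ^ n *_) (^-comm k m n))) ⟩
        V ^ n * (k ^ n) ^ m * (2 ^ ℓ) ^ m                            ≡⟨ xy∙z≈y∙zx (V ^ n) ((k ^ n) ^ m) ((2 ^ ℓ) ^ m) ⟩
        (k ^ n) ^ m * ((2 ^ ℓ) ^ m * V ^ n)                          ∎))
      where
      open ≤-Reasoning
      m = r + r′
      b = length ws
      U = p ^ r * q ^ r′
      V = D ^ m * U
      -- `t₀` is `ρ n` rounded down, and `c` the least weight that a run with at most `t₀` pairs can
      -- have, as `p ≤ q`.
      t₀ = r * n / m
      c = p ^ t₀ * q ^ (n ∸ t₀)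
      rearrange : ∀ x y z t u → x * y * (z * (t * u)) ≡ t * (x * u) * (y * z)
      rearrange = solve-∀
      2^[me+mℓ] : (2 ^ e) ^ m * (2 ^ ℓ) ^ m ≡ 2 ^ (m * e + m * ℓ)
      2^[me+mℓ] = trans (cong₂ _*_ (trans (^-*-assoc 2 e m) (cong (2 ^_) (*-comm e m))) (trans (^-*-assoc 2 ℓ m) (cong (2 ^_) (*-comm ℓ m))))
                        (sym (^-distribˡ-+-* 2 (m * e) (m * ℓ)))
      V^n≢0 : NonZero (V ^ n)
      V^n≢0 = m^n≢0 V n {{m*n≢0 _ _ {{m^n≢0 D m}} {{m*n≢0 _ _ {{m^n≢0 p r}} {{m^n≢0 q r′}}}}}}
      mt₀≤rn : t₀ * m ≤ r * n
      mt₀≤rn = m/n*n≤m (r * n) m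
      t₀≤n : t₀ ≤ n
      t₀≤n = *-cancelʳ-≤ t₀ n m (≤-trans mt₀≤rn (≤-trans (*-monoˡ-≤ n (m≤m+n r r′)) (≤-reflexive (*-comm m n))))
      heavy : ∀ w → m * length (twin (run w)) ≤ r * n → c ≤ weight (run w)
      heavy w mt≤rn = ^-exchange-≤ p≤q t≤t₀ (trans (run-size w) (sym (m+[n∸m]≡n t₀≤n)))
        where
        t = length (twin (run w))
        t≤t₀ : t ≤ t₀
        t≤t₀ = subst (_≤ t₀) (m*n/n≡m t m) (/-monoˡ-≤ m (≤-trans (≤-reflexive (*-comm t m)) mt≤rn))
      U^n≤c^m : U ^ n ≤ c ^ m
      U^n≤c^m = begin
        U ^ n                               ≡⟨ ^-distribʳ-* n (p ^ r) (q ^ r′) ⟩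
        (p ^ r) ^ n * (q ^ r′) ^ n          ≡⟨ cong₂ _*_ (^-*-assoc p r n) (^-*-assoc q r′ n) ⟩
        -- Rounding `ρ n` down only trades factors `p` for factors `q`.
        p ^ (r * n) * q ^ (r′ * n)          ≤⟨ ^-exchange-≤ p≤q mt₀≤rn (trans (sym (*-distribʳ-+ m t₀ (n ∸ t₀))) (trans (cong (_* m) (m+[n∸m]≡n t₀≤n)) (trans (*-comm n m) (*-distribʳ-+ n r r′)))) ⟩
        p ^ (t₀ * m) * q ^ ((n ∸ t₀) * m)   ≡⟨ cong₂ _*_ (^-*-assoc p t₀ m) (^-*-assoc q (n ∸ t₀) m) ⟨
        (p ^ t₀) ^ m * (q ^ (n ∸ t₀)) ^ m   ≡⟨ ^-distribʳ-* m (p ^ t₀) (q ^ (n ∸ t₀)) ⟨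
        c ^ m                               ∎

-- The potential for three letters, and the numerical bounds

data Trie (k : ℕ) : ℕ → Set where
  leaf : ℕ → Trie k zero
  node : ∀ {d} → ℕ → Vec (Trie k d) k → Trie k (suc d)

tabulate : ∀ L → (List (Fin k) → ℕ) → Trie k L
tabulate zero    f = leaf (f [])
tabulate (suc L) f = node (f []) (Vec.tabulate λ a → tabulate L (f ∘ (a ∷_)))

find : ∀ {L} → Trie k L → List (Fin k) → ℕ
find (leaf x)    _       = x
find (node x ts) []      = x
find (node x ts) (a ∷ u) = find (Vec.lookup ts a) u

-- Value iteration; the trie memoises each iterate, which would otherwise take
-- exponential time to evaluate.
table : ∀ k L p q → ℕ → Trie k L
table k L p q zero    = tabulate L (λ _ → 1)
table k L p q (suc i) = tabulate L (Strategy.totalCost k L p q (find (table k L p q i)))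

φ₃ : List (Fin 3) → ℕ
φ₃ = find (table 3 5 2 3 10)

open Strategy 3 5 2 3 φ₃

certificate : Certificate 761 100
certificate = toWitness {a? = certificate? 761 100} _

theorem1p1 : Σ ℕ λ q → Σ ℕ λ N → ∀ n → N ≤ n →
    (L : List (Word 3 n)) → Unique L → All (λ w → ¬ TwinsAtLeast0411 w) L →
    length L * 2 ^ (n / (suc q * suc ⌊log₂ n ⌋)) ≤ 3 ^ n
-- With `m = 1000` and `ℓ = 30`, `suc 1999` is `2 * m` and 60000 is `2 * m * ℓ`.
theorem1p1 = 1999 , 60000 , λ n N≤n L L! bad →
  few-bad-words {P = 761} {D = 100} certificate {r = 411} {r′ = 589} {ℓ = 30}
    (toWitness {a? = 2 ≤? 3} _)
    (toWitness {a? = φ₃ [] ≤? 2 ^ 30} _)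
    (toWitness {a? = 761 ^ 1000 * 2 ≤? 100 ^ 1000 * (2 ^ 411 * 3 ^ 589) * 3 ^ 1000} _)
    n (n / (2000 * suc ⌊log₂ n ⌋)) (exponent-small 1000 30 n ⌊log₂ n ⌋ N≤n) L L!
    -- In a bad word the twins found by the strategy, in particular, are too short.
    (All.map (λ {w} ¬twins → ≰⇒≥ λ le → ¬twins (_ , le , run-twins w)) bad)
  where
  -- Each of the two summands is at most half of `n`.
  exponent-small : ∀ m ℓ n j .{{_ : NonZero (2 * m * suc j)}} → 2 * m * ℓ ≤ n →
    m * (n / (2 * m * suc j)) + m * ℓ ≤ n
  exponent-small m ℓ n j N≤n = *-cancelˡ-≤ 2 (begin
    2 * (m * e + m * ℓ)              ≡⟨ lemma m e ℓ ⟩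
    e * (2 * m) + 2 * m * ℓ          ≤⟨ +-mono-≤ (*-monoʳ-≤ e (m≤m*n (2 * m) (suc j))) N≤n ⟩
    e * (2 * m * suc j) + n          ≤⟨ +-monoˡ-≤ n (m/n*n≤m n (2 * m * suc j)) ⟩
    n + n                            ≡⟨ cong (n +_) (+-identityʳ n) ⟨
    2 * n                            ∎)
    where
    open ≤-Reasoning
    e = n / (2 * m * suc j)
    lemma : ∀ x y z → 2 * (x * y + x * z) ≡ y * (2 * x) + 2 * x * z
    lemma = solve-∀
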